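{- Let $q_n=|\mathcal{Q}_n|$ and let $r(n)$ be the number of $(-1)$-Dyck paths of semi-length $n$. Then: (1) For $n>3$, $$q_n=2 q_{n-1}+q_{n-2}+q_{n-3}+\sum _{i=2}^{n-4} q_{i} (q_{n-i-1}-q_{n-i-2})+1,$$ with the initial values $q_1=0$, $q_2=1$, and $q_3=3$. (2) For $n>3$, $$r(n)=3 r(n-1)-r(n-2)+q_{n-2}+\sum _{i=2}^{n-3} q_{i} (r(n-i-1)-r(n-i-2)),$$ with the initial values $r(1)=1$, $r(2)=2$, and $r(3)=5$.
   Context: A Dyck path is a lattice path in the first quadrant that starts at the origin, ends on the $x$-axis, and consists of steps $U=(1,1)$ and $D=(1,-1)$ (never going below the $x$-axis). Its semi-length is its number of $U$ steps. A valley is an occurrence of two consecutive steps $DU$; the level of a valley is the $y$-coordinate of its lowest point. Let $\nu=(\nu_1,\dots,\nu_k)$ be the levels of all valleys of $P$, listed from left to right. A Dyck path is called $(-1)$-Dyck if it has at most one valley or if $\nu_{i+1}-\nu_i\ge -1$ for all $1\le i<k$. $\mathcal{Q}_n$ is the set of all $(-1)$-Dyck paths of semi-length $n$ that have at least one valley and whose last (rightmost) valley is at ground level (level $0$). Sums whose upper limit is smaller than the lower limit are empty. -}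

module Defs where

open import Data.Integer as ℤ using (ℤ; +_; -1ℤ)
import Data.Integer.Properties as ℤ
open import Data.List using (List; []; _∷_; _++_; [_]; map; filter; foldr; applyUpTo; last; length)
open import Data.List.Membership.Propositional using (_∈_)
open import Data.List.Membership.Propositional.Properties
  using (∈-map⁺; ∈-map⁻; ∈-++⁺ˡ; ∈-++⁺ʳ; ∈-++⁻; ∈-filter⁺; ∈-filter⁻)
open import Data.List.Relation.Unary.All using ([])
open import Data.List.Relation.Unary.AllPairs using ([]; _∷_)
open import Data.List.Relation.Unary.Any using (here)
open import Data.List.Relation.Unary.Linked using (Linked; linked?)
open import Data.List.Relation.Unary.Unique.Propositional using (Unique)
import Data.List.Relation.Unary.Unique.Propositional.Properties as Unique
open import Data.Maybe using (just)
open import Data.Maybe.Properties using (≡-dec)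
open import Data.Nat using (ℕ; zero; suc; _+_; _∸_)
import Data.Nat.Properties as ℕ
open import Data.Product using (_×_; _,_; proj₁; proj₂)
open import Data.Sum using (inj₁; inj₂)
open import Function using (_⇔_; mk⇔; Equivalence)
open import Relation.Binary.PropositionalEquality using (_≡_; refl; cong)
open import Relation.Nullary using (Dec; ¬_)
open import Relation.Nullary.Decidable using (_×-dec_)

-- `Path h` consists of the sequences of steps U = (1,1) and D = (1,-1) that
-- start at height h, end on the x-axis and never go below it.

data Path : ℕ → Set where
  end : Path 0
  U   : ∀ {h} → Path (suc h) → Path h
  D   : ∀ {h} → Path h → Path (suc h)

DyckPath : Set
DyckPath = Path 0

ups : ∀ {h} → Path h → ℕ
ups end   = 0
ups (U p) = suc (ups p)
ups (D p) = ups p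

semilength : DyckPath → ℕ
semilength = ups

-- The levels of the valleys, from left to right.  A step D from height
-- suc h ends at height h, so a valley D U there has its lowest point at h.

valleys : ∀ {h} → Path h → List ℕ
valleys end           = []
valleys (U p)         = valleys p
valleys (D end)       = []
valleys (D (D p))     = valleys (D p)
valleys (D {h} (U p)) = h ∷ valleys p

-- `Linked` relates consecutive entries, and so holds trivially when there
-- is at most one valley.

_⟶_ : ℕ → ℕ → Set
ν ⟶ ν′ = + ν′ ℤ.- + ν ℤ.≥ -1ℤ

Is[-1]Dyck : DyckPath → Set
Is[-1]Dyck P = Linked _⟶_ (valleys P)

-- `last` returns `nothing` on the empty list, so this includes the
-- existence of a valley.

LastValleyAtGround : DyckPath → Set
LastValleyAtGround P = last (valleys P) ≡ just 0

𝓡 : ℕ → DyckPath → Set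
𝓡 n P = semilength P ≡ n × Is[-1]Dyck P

𝓠 : ℕ → DyckPath → Set
𝓠 n P = semilength P ≡ n × Is[-1]Dyck P × LastValleyAtGround P

is[-1]Dyck? : ∀ P → Dec (Is[-1]Dyck P)
is[-1]Dyck? P = linked? (λ ν ν′ → -1ℤ ℤ.≤? (+ ν′ ℤ.- + ν)) (valleys P)

lastValleyAtGround? : ∀ P → Dec (LastValleyAtGround P)
lastValleyAtGround? P = ≡-dec ℕ._≟_ (last (valleys P)) (just 0)

-- All paths from height h with exactly n up steps.

paths : (n h : ℕ) → List (Path h)
paths zero    zero    = [ end ]
paths zero    (suc h) = map D (paths zero h)
paths (suc n) zero    = map U (paths n 1)
paths (suc n) (suc h) = map U (paths n (suc (suc h))) ++ map D (paths (suc n) h)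

𝓡-list : ℕ → List DyckPath
𝓡-list n = filter is[-1]Dyck? (paths n 0)

𝓠-list : ℕ → List DyckPath
𝓠-list n = filter (λ P → is[-1]Dyck? P ×-dec lastValleyAtGround? P) (paths n 0)

-- The cardinalities of 𝓡 n and 𝓠 n; see 𝓡-enumerated and 𝓠-enumerated.

r : ℕ → ℕ
r n = length (𝓡-list n)

q : ℕ → ℕ
q n = length (𝓠-list n)

-- ∑ a b f = f a + ⋯ + f b.  The number of terms is suc b ∸ a, which is 0
-- when b < a.

∑ : ℕ → ℕ → (ℕ → ℤ) → ℤ
∑ a b f = foldr ℤ._+_ (+ 0) (applyUpTo (λ k → f (a + k)) (suc b ∸ a))

infix 7 ∑
syntax ∑ a b (λ i → e) = ∑[ i from a to b ] e

-- The lists above contain every element of the corresponding set exactly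
-- once, so their lengths are the cardinalities.

_Enumerates_ : {A : Set} → List A → (A → Set) → Set
xs Enumerates S = Unique xs × (∀ x → x ∈ xs ⇔ S x)

private
  U-inj : ∀ {h} {p p′ : Path (suc h)} → U p ≡ U p′ → p ≡ p′
  U-inj refl = refl

  D-inj : ∀ {h} {p p′ : Path h} → D p ≡ D p′ → p ≡ p′
  D-inj refl = refl

  paths-unique : (n h : ℕ) → Unique (paths n h)
  paths-unique zero    zero    = [] ∷ []
  paths-unique zero    (suc h) = Unique.map⁺ D-inj (paths-unique zero h)
  paths-unique (suc n) zero    = Unique.map⁺ U-inj (paths-unique n 1)
  paths-unique (suc n) (suc h) =
    Unique.++⁺ (Unique.map⁺ U-inj (paths-unique n _))
               (Unique.map⁺ D-inj (paths-unique (suc n) h))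
               λ (∈U , ∈D) → disjoint ∈U ∈D
    where
    disjoint : ∀ {p} → p ∈ map U (paths n (suc (suc h))) →
               ¬ (p ∈ map D (paths (suc n) h))
    disjoint ∈U ∈D with ∈-map⁻ U ∈U | ∈-map⁻ D ∈D
    ... | _ , _ , refl | _ , _ , ()

  paths-complete : ∀ {h} (p : Path h) → p ∈ paths (ups p) h
  paths-complete end = here refl
  paths-complete (U {zero}  p) = ∈-map⁺ U (paths-complete p)
  paths-complete (U {suc h} p) = ∈-++⁺ˡ (∈-map⁺ U (paths-complete p))
  paths-complete (D p) with ups p | paths-complete p
  ... | zero  | p∈ = ∈-map⁺ D p∈
  ... | suc n | p∈ = ∈-++⁺ʳ (map U (paths n _)) (∈-map⁺ D p∈)

  paths-sound : (n h : ℕ) {p : Path h} → p ∈ paths n h → ups p ≡ n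
  paths-sound zero    zero    (here refl) = refl
  paths-sound zero    (suc h) p∈ with ∈-map⁻ D p∈
  ... | _ , p′∈ , refl = paths-sound zero h p′∈
  paths-sound (suc n) zero    p∈ with ∈-map⁻ U p∈
  ... | _ , p′∈ , refl = cong suc (paths-sound n 1 p′∈)
  paths-sound (suc n) (suc h) p∈ with ∈-++⁻ (map U (paths n (suc (suc h)))) p∈
  ... | inj₁ p∈ˡ with ∈-map⁻ U p∈ˡ
  ...   | _ , p′∈ , refl = cong suc (paths-sound n _ p′∈)
  paths-sound (suc n) (suc h) p∈ | inj₂ p∈ʳ with ∈-map⁻ D p∈ʳ
  ...   | _ , p′∈ , refl = paths-sound (suc n) h p′∈

paths-enumerated : (n h : ℕ) → paths n h Enumerates (λ p → ups p ≡ n)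
paths-enumerated n h =
  paths-unique n h , λ p → mk⇔ (paths-sound n h) λ { refl → paths-complete p }

private
  filter-enumerates : {A : Set} {S T : A → Set} (T? : ∀ x → Dec (T x)) {xs : List A} →
                      xs Enumerates S → filter T? xs Enumerates (λ x → S x × T x)
  filter-enumerates T? {xs} (xs! , xs⇔) =
    Unique.filter⁺ T? xs! , λ x → mk⇔
      (λ x∈ → let x∈xs , Tx = ∈-filter⁻ T? {xs = xs} x∈ in
              Equivalence.to (xs⇔ x) x∈xs , Tx)
      (λ (Sx , Tx) → ∈-filter⁺ T? (Equivalence.from (xs⇔ x) Sx) Tx)

𝓡-enumerated : ∀ n → 𝓡-list n Enumerates 𝓡 n
𝓡-enumerated n = filter-enumerates is[-1]Dyck? (paths-enumerated n 0)

𝓠-enumerated : ∀ n → 𝓠-list n Enumerates 𝓠 n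
𝓠-enumerated n =
  filter-enumerates (λ P → is[-1]Dyck? P ×-dec lastValleyAtGround? P) (paths-enumerated n 0)

{-# OPTIONS --safe #-}
module Submission where

-- Cut a nonempty Dyck path at its first return to the axis, as U A D B.  Its
-- valleys are those of A raised by 1, then, unless B is empty, one valley at
-- level 0, then those of B (`valleys-glue-end`, `valleys-glue-U`).  So for
-- nonempty B the path is (-1)-Dyck exactly when A and B are and A has either
-- no valley or its last valley at level 0 (`linked-join`); for empty B it is
-- exactly when A is.  Let t a be the number of (-1)-Dyck paths of semi-length
-- a with no valley or with the last valley at level 0.  As exactly one path
-- has no valley, t a = 1 + q a (`t≡1+q`).  Moreover, the last valley of
-- U A D B is at level 0 exactly when B is nonempty and has no valley or its
-- last valley at level 0.  Hence
--
--   q (m + 2) =             sum over a + b = m of t a * t (b + 1)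
--   r (m + 2) = r (m + 1) + sum over a + b = m of t a * r (b + 1)
--
-- (`q-convolution`, `r-convolution`), and subtracting consecutive instances
-- gives both recurrences (`convolution-step`).
--
-- Instead of a bijection between lists, the counting manipulates weighted
-- sums over the enumerated paths: `first-return` says that a sum over the
-- paths from height h + 1 is a convolution of sums over the paths from h and
-- over the Dyck paths, and holds by induction along the recursion that
-- generates the paths.

open import Defs
import Data.Integer.Properties as ℤ
open import Algebra.Properties.CommutativeSemigroup ℤ.+-commutativeSemigroup
  using (interchange; x∙yz≈y∙xz)
open import Data.Bool using (if_then_else_; true; false)
open import Data.Integer using (ℤ; +_; _+_; _-_; _*_; 0ℤ; 1ℤ; -1ℤ; -≤+; -≤-)
open import Data.Integer.Tactic.RingSolver using (solve-∀)
open import Data.List using (List; []; _∷_; _++_; map; filter; foldr; applyUpTo; last; length)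
open import Data.List.Relation.Unary.Linked using (Linked; linked?; []; [-]; _∷_)
open import Data.Empty using (⊥; ⊥-elim)
open import Data.Maybe using (just; nothing)
open import Data.Maybe.Properties using (≡-dec)
open import Data.Maybe.Relation.Unary.All as Maybe using (just; nothing)
open import Data.Nat using (ℕ; zero; suc; _∸_; _>_; z≤n; s≤s)
import Data.Nat as ℕ
import Data.Nat.Properties as ℕ
open import Data.Product using (_×_; _,_)
open import Function using (_∘_; _⇔_; mk⇔; Equivalence)
open import Relation.Binary.PropositionalEquality
  using (_≡_; _≢_; refl; sym; trans; cong; cong₂; module ≡-Reasoning)
open import Relation.Nullary using (Dec; yes; no; does; contradiction)
open import Relation.Nullary.Decidable using (_×-dec_)

open Equivalence using (to; from)

+-congˡ : ∀ i {j k : ℤ} → j ≡ k → i + j ≡ i + k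
+-congˡ i = cong (λ j → i + j)

-- Sums over lists

-- `sumOver f xs` is the sum of f x over the entries x of xs, with repetition.

sumOver : ∀ {A : Set} → (A → ℤ) → List A → ℤ
sumOver f []       = 0ℤ
sumOver f (x ∷ xs) = f x + sumOver f xs

module _ {A : Set} where

  sumOver-cong : {f g : A → ℤ} → (∀ x → f x ≡ g x) → ∀ xs → sumOver f xs ≡ sumOver g xs
  sumOver-cong f≡g []       = refl
  sumOver-cong f≡g (x ∷ xs) = cong₂ _+_ (f≡g x) (sumOver-cong f≡g xs)

  sumOver-zero : {f : A → ℤ} → (∀ x → f x ≡ 0ℤ) → ∀ xs → sumOver f xs ≡ 0ℤ
  sumOver-zero f≡0 []       = refl
  sumOver-zero f≡0 (x ∷ xs) = cong₂ _+_ (f≡0 x) (sumOver-zero f≡0 xs)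

  sumOver-++ : (f : A → ℤ) → ∀ xs ys → sumOver f (xs ++ ys) ≡ sumOver f xs + sumOver f ys
  sumOver-++ f []       ys = sym (ℤ.+-identityˡ _)
  sumOver-++ f (x ∷ xs) ys =
    trans (+-congˡ (f x) (sumOver-++ f xs ys)) (sym (ℤ.+-assoc (f x) _ (sumOver f ys)))

  sumOver-map : {B : Set} (f : A → ℤ) (g : B → A) → ∀ xs →
                sumOver f (map g xs) ≡ sumOver (f ∘ g) xs
  sumOver-map f g []       = refl
  sumOver-map f g (x ∷ xs) = +-congˡ (f (g x)) (sumOver-map f g xs)

  sumOver-+ : (f g : A → ℤ) → ∀ xs →
              sumOver (λ x → f x + g x) xs ≡ sumOver f xs + sumOver g xs
  sumOver-+ f g []       = refl
  sumOver-+ f g (x ∷ xs) =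
    trans (+-congˡ (f x + g x) (sumOver-+ f g xs))
          (interchange (f x) (g x) (sumOver f xs) (sumOver g xs))

  sumOver-*ˡ : (c : ℤ) (f : A → ℤ) → ∀ xs → sumOver (λ x → c * f x) xs ≡ c * sumOver f xs
  sumOver-*ˡ c f []       = sym (ℤ.*-zeroʳ c)
  sumOver-*ˡ c f (x ∷ xs) =
    trans (+-congˡ (c * f x) (sumOver-*ˡ c f xs)) (sym (ℤ.*-distribˡ-+ c (f x) _))

  sumOver-*ʳ : (c : ℤ) (f : A → ℤ) → ∀ xs → sumOver (λ x → f x * c) xs ≡ sumOver f xs * c
  sumOver-*ʳ c f []       = refl
  sumOver-*ʳ c f (x ∷ xs) =
    trans (+-congˡ (f x * c) (sumOver-*ʳ c f xs)) (sym (ℤ.*-distribʳ-+ c (f x) _))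

-- Indicators of decidable propositions

-- The value is 1 if P holds and 0 otherwise.

𝟙 : {P : Set} → Dec P → ℤ
𝟙 P? = if does P? then 1ℤ else 0ℤ

𝟙-cong : {P Q : Set} (P? : Dec P) (Q? : Dec Q) → P ⇔ Q → 𝟙 P? ≡ 𝟙 Q?
𝟙-cong (yes p) (yes q) P⇔Q = refl
𝟙-cong (yes p) (no ¬q) P⇔Q = contradiction (to P⇔Q p) ¬q
𝟙-cong (no ¬p) (yes q) P⇔Q = contradiction (from P⇔Q q) ¬p
𝟙-cong (no ¬p) (no ¬q) P⇔Q = refl

𝟙-× : {P Q : Set} (P? : Dec P) (Q? : Dec Q) → 𝟙 (P? ×-dec Q?) ≡ 𝟙 P? * 𝟙 Q?
𝟙-× (yes _) (yes _) = refl
𝟙-× (yes _) (no _)  = refl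
𝟙-× (no _)  _       = refl

length-filter : {A : Set} {P : A → Set} (P? : ∀ x → Dec (P x)) → ∀ xs →
                + length (filter P? xs) ≡ sumOver (𝟙 ∘ P?) xs
length-filter P? []       = refl
length-filter P? (x ∷ xs) with does (P? x)
... | true  = +-congˡ 1ℤ (length-filter P? xs)
... | false = trans (length-filter P? xs) (sym (ℤ.+-identityˡ _))

-- Convolution sums

-- `conv n F` is the sum of F a b over all a + b = n.

conv : ℕ → (ℕ → ℕ → ℤ) → ℤ
conv zero    F = F 0 0
conv (suc n) F = F 0 (suc n) + conv n (λ a b → F (suc a) b)

conv-cong-on : ∀ n {F G : ℕ → ℕ → ℤ} →
               (∀ a b → a ℕ.+ b ≡ n → F a b ≡ G a b) →
               conv n F ≡ conv n G
conv-cong-on zero    F≡G = F≡G 0 0 refl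
conv-cong-on (suc n) F≡G =
  cong₂ _+_ (F≡G 0 (suc n) refl) (conv-cong-on n (λ a b e → F≡G (suc a) b (cong suc e)))

conv-cong : ∀ n {F G : ℕ → ℕ → ℤ} → (∀ a b → F a b ≡ G a b) → conv n F ≡ conv n G
conv-cong n F≡G = conv-cong-on n (λ a b _ → F≡G a b)

conv-+ : ∀ n (F G : ℕ → ℕ → ℤ) → conv n (λ a b → F a b + G a b) ≡ conv n F + conv n G
conv-+ zero    F G = refl
conv-+ (suc n) F G =
  trans (+-congˡ (F 0 (suc n) + G 0 (suc n)) (conv-+ n F′ G′))
        (interchange (F 0 (suc n)) (G 0 (suc n)) (conv n F′) (conv n G′))
  where
  F′ G′ : ℕ → ℕ → ℤ
  F′ a b = F (suc a) b
  G′ a b = G (suc a) b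

-- Splitting off the term b = 0 rather than a = 0.

conv-last : ∀ n (F : ℕ → ℕ → ℤ) →
            conv (suc n) F ≡ conv n (λ a b → F a (suc b)) + F (suc n) 0
conv-last zero    F = refl
conv-last (suc n) F =
  trans (+-congˡ (F 0 (2 ℕ.+ n)) (conv-last n (λ a b → F (suc a) b)))
        (sym (ℤ.+-assoc (F 0 (2 ℕ.+ n)) _ (F (2 ℕ.+ n) 0)))

telescope : ∀ m (s : ℕ → ℤ) → conv m (λ _ b → s (suc b) - s b) ≡ s (suc m) - s 0
telescope zero    s = refl
telescope (suc m) s =
  trans (+-congˡ (s (2 ℕ.+ m) - s (1 ℕ.+ m)) (telescope m s))
        (cancel (s (2 ℕ.+ m)) (s (1 ℕ.+ m)) (s 0))
  where
  cancel : ∀ i j k → (i - j) + (j - k) ≡ i - k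
  cancel = solve-∀

-- The left-hand side is the form that a sum written with ∑ unfolds to.

foldr-applyUpTo : ∀ m (f : ℕ → ℤ) →
                  foldr _+_ (+ 0) (applyUpTo f (suc m)) ≡ conv m (λ a _ → f a)
foldr-applyUpTo zero    f = ℤ.+-identityʳ (f 0)
foldr-applyUpTo (suc m) f = +-congˡ (f 0) (foldr-applyUpTo m (f ∘ suc))

-- The passage to ∑ with the lower limit 2.  It also holds for m < 2, when the
-- sum on the right is empty.

conv-from-2 : ∀ m (F : ℕ → ℕ → ℤ) (f : ℕ → ℤ) →
              (∀ b → F 0 b ≡ 0ℤ) → (∀ b → F 1 b ≡ 0ℤ) →
              (∀ a b → a ℕ.+ b ≡ m → F a b ≡ f a) →
              conv m F ≡ ∑[ i from 2 to m ] f i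
conv-from-2 zero          F f F0 F1 F≡f = F0 0
conv-from-2 (suc zero)    F f F0 F1 F≡f = cong₂ _+_ (F0 1) (F1 0)
conv-from-2 (suc (suc m)) F f F0 F1 F≡f = begin
  F 0 (2 ℕ.+ m) + (F 1 (1 ℕ.+ m) + conv m (λ a b → F (2 ℕ.+ a) b))
    ≡⟨ cong₂ _+_ (F0 _) (cong₂ _+_ (F1 _) refl) ⟩
  0ℤ + (0ℤ + conv m (λ a b → F (2 ℕ.+ a) b))
    ≡⟨ trans (ℤ.+-identityˡ _) (ℤ.+-identityˡ _) ⟩
  conv m (λ a b → F (2 ℕ.+ a) b)
    ≡⟨ conv-cong-on m (λ a b e → F≡f (2 ℕ.+ a) b (cong (2 ℕ.+_) e)) ⟩
  conv m (λ a _ → f (2 ℕ.+ a))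
    ≡⟨ foldr-applyUpTo m (λ a → f (2 ℕ.+ a)) ⟨
  ∑ 2 (2 ℕ.+ m) f ∎
  where open ≡-Reasoning

-- First-return decomposition

-- `glue A B` is A raised by 1, then a step D to the axis, then B.  Every path
-- from height suc h arises uniquely in this way.

glue : ∀ {h} → Path h → DyckPath → Path (suc h)
glue end   B = D B
glue (U A) B = U (glue A B)
glue (D A) B = D (glue A B)

-- The sum of f over all paths from height h with n up steps.

sumPaths : (n h : ℕ) → (Path h → ℤ) → ℤ
sumPaths n h f = sumOver f (paths n h)

sumPaths-cong : ∀ n h {f g : Path h → ℤ} → (∀ p → f p ≡ g p) → sumPaths n h f ≡ sumPaths n h g
sumPaths-cong n h f≡g = sumOver-cong f≡g (paths n h)

sumPaths-zero-suc : ∀ h (f : Path (suc h) → ℤ) → sumPaths 0 (suc h) f ≡ sumPaths 0 h (f ∘ D)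
sumPaths-zero-suc h f = sumOver-map f D (paths 0 h)

sumPaths-suc-zero : ∀ n (f : Path 0 → ℤ) → sumPaths (suc n) 0 f ≡ sumPaths n 1 (f ∘ U)
sumPaths-suc-zero n f = sumOver-map f U (paths n 1)

sumPaths-suc-suc : ∀ n h (f : Path (suc h) → ℤ) →
  sumPaths (suc n) (suc h) f ≡ sumPaths n (suc (suc h)) (f ∘ U) + sumPaths (suc n) h (f ∘ D)
sumPaths-suc-suc n h f =
  trans (sumOver-++ f (map U (paths n _)) _)
        (cong₂ _+_ (sumOver-map f U (paths n _)) (sumOver-map f D (paths (suc n) h)))

first-return : ∀ n h (f : Path (suc h) → ℤ) →
  sumPaths n (suc h) f ≡
  conv n (λ a b → sumPaths a h (λ A → sumPaths b 0 (λ B → f (glue A B))))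
first-return zero zero f = sym (ℤ.+-identityʳ _)
first-return zero (suc h) f = begin
  sumPaths 0 (suc (suc h)) f
    ≡⟨ sumPaths-zero-suc (suc h) f ⟩
  sumPaths 0 (suc h) (f ∘ D)
    ≡⟨ first-return zero h (f ∘ D) ⟩
  sumPaths 0 h (λ A → sumPaths 0 0 (λ B → f (D (glue A B))))
    ≡⟨ sumPaths-zero-suc h _ ⟨
  sumPaths 0 (suc h) (λ A → sumPaths 0 0 (λ B → f (glue A B))) ∎
  where open ≡-Reasoning
first-return (suc n) zero f = begin
  sumPaths (suc n) 1 f
    ≡⟨ sumPaths-suc-suc n 0 f ⟩
  sumPaths n 2 (f ∘ U) + sumPaths (suc n) 0 (f ∘ D)
    ≡⟨ ℤ.+-comm (sumPaths n 2 (f ∘ U)) _ ⟩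
  sumPaths (suc n) 0 (f ∘ D) + sumPaths n 2 (f ∘ U)
    ≡⟨ cong₂ _+_ (sym (ℤ.+-identityʳ (sumPaths (suc n) 0 (f ∘ D)))) (first-return n 1 (f ∘ U)) ⟩
  F 0 (suc n) + conv n (λ a b → sumPaths a 1 (λ A → sumPaths b 0 (λ B → f (U (glue A B)))))
    ≡⟨ +-congˡ (F 0 (suc n)) (conv-cong n (λ a b → sym (sumPaths-suc-zero a _))) ⟩
  conv (suc n) F ∎
  where
  open ≡-Reasoning
  F : ℕ → ℕ → ℤ
  F a b = sumPaths a 0 (λ A → sumPaths b 0 (λ B → f (glue A B)))
first-return (suc n) (suc h) f = begin
  sumPaths (suc n) (suc (suc h)) f
    ≡⟨ sumPaths-suc-suc n (suc h) f ⟩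
  sumPaths n (suc (suc (suc h))) (f ∘ U) + sumPaths (suc n) (suc h) (f ∘ D)
    ≡⟨ cong₂ _+_ (first-return n (suc (suc h)) (f ∘ U)) (first-return (suc n) h (f ∘ D)) ⟩
  conv n G + (H 0 (suc n) + conv n (λ a b → H (suc a) b))
    ≡⟨ x∙yz≈y∙xz (conv n G) (H 0 (suc n)) _ ⟩
  H 0 (suc n) + (conv n G + conv n (λ a b → H (suc a) b))
    ≡⟨ cong₂ _+_ (sym (sumPaths-zero-suc h _)) (sym (conv-+ n G _)) ⟩
  F 0 (suc n) + conv n (λ a b → G a b + H (suc a) b)
    ≡⟨ +-congˡ (F 0 (suc n)) (conv-cong n (λ a b → sym (sumPaths-suc-suc a h _))) ⟩
  conv (suc n) F ∎
  where
  open ≡-Reasoning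
  F G H : ℕ → ℕ → ℤ
  F a b = sumPaths a (suc h) (λ A → sumPaths b 0 (λ B → f (glue A B)))
  G a b = sumPaths a (suc (suc h)) (λ A → sumPaths b 0 (λ B → f (U (glue A B))))
  H a b = sumPaths a h (λ A → sumPaths b 0 (λ B → f (D (glue A B))))

-- The shape in which the decomposition is used: e is the weight of U A D,
-- and the weight of U A D B for nonempty B = U B′ splits as g A * w B.

sumPaths-factor : ∀ m (f e g w : DyckPath → ℤ) →
  (∀ A → f (U (glue A end)) ≡ e A) →
  (∀ A B′ → f (U (glue A (U B′))) ≡ g A * w (U B′)) →
  sumPaths (2 ℕ.+ m) 0 f ≡
  sumPaths (1 ℕ.+ m) 0 e + conv m (λ a b → sumPaths a 0 g * sumPaths (suc b) 0 w)
sumPaths-factor m f e g w f≡e f≡gw = begin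
  sumPaths (2 ℕ.+ m) 0 f
    ≡⟨ sumPaths-suc-zero (suc m) f ⟩
  sumPaths (suc m) 1 (f ∘ U)
    ≡⟨ first-return (suc m) 0 (f ∘ U) ⟩
  conv (suc m) F
    ≡⟨ conv-last m F ⟩
  conv m (λ a b → F a (suc b)) + F (suc m) 0
    ≡⟨ cong₂ _+_ (conv-cong m nonempty) empty ⟩
  conv m (λ a b → sumPaths a 0 g * sumPaths (suc b) 0 w) + sumPaths (suc m) 0 e
    ≡⟨ ℤ.+-comm _ (sumPaths (suc m) 0 e) ⟩
  sumPaths (suc m) 0 e + conv m (λ a b → sumPaths a 0 g * sumPaths (suc b) 0 w) ∎
  where
  open ≡-Reasoning
  F : ℕ → ℕ → ℤ
  F a b = sumPaths a 0 (λ A → sumPaths b 0 (λ B → f (U (glue A B))))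

  empty : F (suc m) 0 ≡ sumPaths (suc m) 0 e
  empty = sumPaths-cong (suc m) 0 (λ A → trans (ℤ.+-identityʳ _) (f≡e A))

  inner : ∀ b A → sumPaths (suc b) 0 (λ B → f (U (glue A B))) ≡ g A * sumPaths (suc b) 0 w
  inner b A = begin
    sumPaths (suc b) 0 (λ B → f (U (glue A B)))  ≡⟨ sumPaths-suc-zero b _ ⟩
    sumPaths b 1 (λ B′ → f (U (glue A (U B′))))  ≡⟨ sumPaths-cong b 1 (f≡gw A) ⟩
    sumPaths b 1 (λ B′ → g A * w (U B′))         ≡⟨ sumPaths-suc-zero b _ ⟨
    sumPaths (suc b) 0 (λ B → g A * w B)         ≡⟨ sumOver-*ˡ (g A) w (paths (suc b) 0) ⟩
    g A * sumPaths (suc b) 0 w                   ∎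

  nonempty : ∀ a b → F a (suc b) ≡ sumPaths a 0 g * sumPaths (suc b) 0 w
  nonempty a b = trans (sumPaths-cong a 0 (inner b)) (sumOver-*ʳ _ g (paths a 0))

-- Valleys of a decomposed path

valleys-glue-end : ∀ {h} (A : Path h) → valleys (glue A end) ≡ map suc (valleys A)
valleys-glue-end end       = refl
valleys-glue-end (U A)     = valleys-glue-end A
valleys-glue-end (D end)   = refl
valleys-glue-end (D (U A)) = cong (_ ∷_) (valleys-glue-end A)
valleys-glue-end (D (D A)) = valleys-glue-end (D A)

valleys-glue-U : ∀ {h} (A : Path h) (B : Path 1) →
                 valleys (glue A (U B)) ≡ map suc (valleys A) ++ 0 ∷ valleys B
valleys-glue-U end       B = refl
valleys-glue-U (U A)     B = valleys-glue-U A B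
valleys-glue-U (D end)   B = refl
valleys-glue-U (D (U A)) B = cong (_ ∷_) (valleys-glue-U A B)
valleys-glue-U (D (D A)) B = valleys-glue-U (D A) B

suc-⟶-suc : ∀ x y → (+ suc y - + suc x) ≡ (+ y - + x)
suc-⟶-suc x y =
  trans (ℤ.m-n≡m⊖n (suc y) (suc x)) (trans (ℤ.[1+m]⊖[1+n]≡m⊖n y x) (sym (ℤ.m-n≡m⊖n y x)))

suc-⟶⇔ : ∀ x y → suc x ⟶ suc y ⇔ x ⟶ y
suc-⟶⇔ x y rewrite suc-⟶-suc x y = mk⇔ (λ z → z) (λ z → z)

0-⟶ : ∀ y → 0 ⟶ y
0-⟶ y = -≤+

linked-map-suc : ∀ xs → Linked _⟶_ (map suc xs) ⇔ Linked _⟶_ xs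
linked-map-suc xs = mk⇔ (down xs) (up xs)
  where
  down : ∀ xs → Linked _⟶_ (map suc xs) → Linked _⟶_ xs
  down []           _       = []
  down (x ∷ [])     _       = [-]
  down (x ∷ y ∷ xs) (l ∷ L) = to (suc-⟶⇔ x y) l ∷ down (y ∷ xs) L
  up : ∀ xs → Linked _⟶_ xs → Linked _⟶_ (map suc xs)
  up []           _       = []
  up (x ∷ [])     _       = [-]
  up (x ∷ y ∷ xs) (l ∷ L) = from (suc-⟶⇔ x y) l ∷ up (y ∷ xs) L

-- The last entry, if there is one, is 0.

LastZero : List ℕ → Set
LastZero xs = Maybe.All (_≡ 0) (last xs)

linked-0∷ : ∀ ys → Linked _⟶_ (0 ∷ ys) ⇔ Linked _⟶_ ys
linked-0∷ []       = mk⇔ (λ _ → []) (λ _ → [-])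
linked-0∷ (y ∷ ys) = mk⇔ (λ { (_ ∷ L) → L }) (0-⟶ y ∷_)

-- The entry before the separating 0 may be at most 1, and is the successor
-- of the last entry of xs.

linked-join : ∀ xs ys → Linked _⟶_ (map suc xs ++ 0 ∷ ys) ⇔
                        ((Linked _⟶_ xs × LastZero xs) × Linked _⟶_ ys)
linked-join xs ys = mk⇔ (split xs) (join xs)
  where
  split : ∀ xs → Linked _⟶_ (map suc xs ++ 0 ∷ ys) →
          (Linked _⟶_ xs × LastZero xs) × Linked _⟶_ ys
  split []            L             = ([] , nothing) , to (linked-0∷ ys) L
  split (x ∷ [])      (-≤- x≤0 ∷ L) = ([-] , just (ℕ.n≤0⇒n≡0 x≤0)) , to (linked-0∷ ys) L
  split (x ∷ x′ ∷ xs) (l ∷ L)       =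
    let (Lxs , z) , Lys = split (x′ ∷ xs) L in (to (suc-⟶⇔ x x′) l ∷ Lxs , z) , Lys
  join : ∀ xs → (Linked _⟶_ xs × LastZero xs) × Linked _⟶_ ys →
         Linked _⟶_ (map suc xs ++ 0 ∷ ys)
  join []            (_ , L)                = from (linked-0∷ ys) L
  join (x ∷ [])      ((_ , just refl) , L)  = -≤- z≤n ∷ from (linked-0∷ ys) L
  join (x ∷ x′ ∷ xs) ((l ∷ Lxs , z) , Lys)  =
    from (suc-⟶⇔ x x′) l ∷ join (x′ ∷ xs) ((Lxs , z) , Lys)

last-++-∷ : ∀ {A : Set} (xs : List A) y ys → last (xs ++ y ∷ ys) ≡ last (y ∷ ys)
last-++-∷ []            y ys = refl
last-++-∷ (x ∷ [])      y ys = refl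
last-++-∷ (x ∷ x′ ∷ xs) y ys = last-++-∷ (x′ ∷ xs) y ys

last-map-suc≢0 : ∀ xs → last (map suc xs) ≢ just 0
last-map-suc≢0 []            = λ ()
last-map-suc≢0 (x ∷ [])      = λ ()
last-map-suc≢0 (x ∷ x′ ∷ xs) = last-map-suc≢0 (x′ ∷ xs)

last-0∷ : ∀ ys → last (0 ∷ ys) ≡ just 0 ⇔ LastZero ys
last-0∷ []       = mk⇔ (λ _ → nothing) (λ _ → refl)
last-0∷ (y ∷ ys) = last-nonempty y ys
  where
  last-nonempty : ∀ y ys → last (y ∷ ys) ≡ just 0 ⇔ LastZero (y ∷ ys)
  last-nonempty y []        = mk⇔ (λ { refl → just refl }) (λ { (just refl) → refl })
  last-nonempty y (y′ ∷ ys) = last-nonempty y′ ys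

-- Weights of Dyck paths

lastZero? : ∀ xs → Dec (LastZero xs)
lastZero? xs = Maybe.dec (λ x → x ℕ.≟ 0) (last xs)

-- The indicator of the (-1)-Dyck paths.

dyck : DyckPath → ℤ
dyck P = 𝟙 (is[-1]Dyck? P)

-- The indicator of the (-1)-Dyck paths that have no valley or whose last
-- valley is at ground level: those that may precede a valley at height 0 after
-- being raised by 1.

groundOrNone? : ∀ P → Dec (Is[-1]Dyck P × LastZero (valleys P))
groundOrNone? P = is[-1]Dyck? P ×-dec lastZero? (valleys P)

groundOrNone : DyckPath → ℤ
groundOrNone P = 𝟙 (groundOrNone? P)

-- The indicator of the (-1)-Dyck paths that have a last valley, at ground level.

ground? : ∀ P → Dec (Is[-1]Dyck P × LastValleyAtGround P)
ground? P = is[-1]Dyck? P ×-dec lastValleyAtGround? P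

ground : DyckPath → ℤ
ground P = 𝟙 (ground? P)

dyck-empty : ∀ A → dyck (U (glue A end)) ≡ dyck A
dyck-empty A = 𝟙-cong (is[-1]Dyck? (U (glue A end))) (is[-1]Dyck? A) shifted
  where
  shifted : Is[-1]Dyck (U (glue A end)) ⇔ Is[-1]Dyck A
  shifted rewrite valleys-glue-end A = linked-map-suc (valleys A)

dyck-nonempty : ∀ A B → dyck (U (glue A (U B))) ≡ groundOrNone A * dyck (U B)
dyck-nonempty A B =
  trans (𝟙-cong (is[-1]Dyck? (U (glue A (U B)))) (groundOrNone? A ×-dec is[-1]Dyck? (U B)) joined)
        (𝟙-× (groundOrNone? A) (is[-1]Dyck? (U B)))
  where
  joined : Is[-1]Dyck (U (glue A (U B))) ⇔
           ((Is[-1]Dyck A × LastZero (valleys A)) × Is[-1]Dyck (U B))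
  joined rewrite valleys-glue-U A B = linked-join (valleys A) (valleys B)

ground-empty : ∀ A → ground (U (glue A end)) ≡ 0ℤ
ground-empty A = 𝟙-cong (ground? (U (glue A end))) (no (λ x → x)) (mk⇔ impossible ⊥-elim)
  where
  impossible : Is[-1]Dyck (U (glue A end)) × LastValleyAtGround (U (glue A end)) → ⊥
  impossible (_ , e) rewrite valleys-glue-end A = last-map-suc≢0 (valleys A) e

ground-nonempty : ∀ A B → ground (U (glue A (U B))) ≡ groundOrNone A * groundOrNone (U B)
ground-nonempty A B =
  trans (𝟙-cong (ground? (U (glue A (U B)))) (groundOrNone? A ×-dec groundOrNone? (U B)) joined)
        (𝟙-× (groundOrNone? A) (groundOrNone? (U B)))
  where
  joined : (Is[-1]Dyck (U (glue A (U B))) × LastValleyAtGround (U (glue A (U B)))) ⇔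
           ((Is[-1]Dyck A × LastZero (valleys A)) × (Is[-1]Dyck (U B) × LastZero (valleys B)))
  joined rewrite valleys-glue-U A B | last-++-∷ (map suc (valleys A)) 0 (valleys B) =
    mk⇔ (λ (L , e) → let LA , LB = to join L in LA , LB , to (last-0∷ (valleys B)) e)
        (λ (LA , LB , z) → from join (LA , LB) , from (last-0∷ (valleys B)) z)
    where join = linked-join (valleys A) (valleys B)

-- The indicator of the empty list; on the valleys of a path, that of the
-- paths without valleys.

null : List ℕ → ℤ
null []      = 1ℤ
null (_ ∷ _) = 0ℤ

-- The two cases exclude each other.

groundOrNone-split : ∀ P → groundOrNone P ≡ null (valleys P) + ground P
groundOrNone-split P with valleys P
... | []     = refl
... | x ∷ xs =
  trans (𝟙-cong (linked ×-dec lastZero? (x ∷ xs)) (linked ×-dec isZero)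
                (mk⇔ (λ (L , z) → L , from (last-0∷ (x ∷ xs)) z)
                     (λ (L , e) → L , to (last-0∷ (x ∷ xs)) e)))
        (sym (ℤ.+-identityˡ _))
  where
  linked = linked? (λ ν ν′ → -1ℤ ℤ.≤? (+ ν′ - + ν)) (x ∷ xs)
  isZero = ≡-dec ℕ._≟_ (last (x ∷ xs)) (just 0)

-- A path that begins with D and still has an up step has a valley, so no such
-- path is counted.

valley-after-D : ∀ n h → sumPaths (suc n) h (λ p → null (valleys (D p))) ≡ 0ℤ
valley-after-D n zero    =
  trans (sumPaths-suc-zero n _) (sumOver-zero (λ _ → refl) (paths n 1))
valley-after-D n (suc h) =
  trans (sumPaths-suc-suc n h _)
        (cong₂ _+_ (sumOver-zero (λ _ → refl) (paths n _)) (valley-after-D n h))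

-- Exactly one path with n up steps has no valleys: the one that takes all of
-- them first.

one-without-valleys : ∀ n h → sumPaths n h (λ p → null (valleys p)) ≡ 1ℤ
one-without-valleys zero zero          = refl
one-without-valleys zero (suc zero)    = refl
one-without-valleys zero (suc (suc h)) =
  trans (sumPaths-zero-suc (suc h) _)
  (trans (sumPaths-zero-suc h _)
  (trans (sym (sumPaths-zero-suc h _)) (one-without-valleys zero (suc h))))
one-without-valleys (suc n) zero    =
  trans (sumPaths-suc-zero n _) (one-without-valleys n 1)
one-without-valleys (suc n) (suc h) =
  trans (sumPaths-suc-suc n h _)
        (cong₂ _+_ (one-without-valleys n _) (valley-after-D n h))

-- Convolution formulas

-- The number of (-1)-Dyck paths of semi-length n that have no valley or whose
-- last valley is at ground level.

t : ℕ → ℤ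
t n = sumPaths n 0 groundOrNone

q≡sumPaths : ∀ n → + q n ≡ sumPaths n 0 ground
q≡sumPaths n = length-filter ground? (paths n 0)

r≡sumPaths : ∀ n → + r n ≡ sumPaths n 0 dyck
r≡sumPaths n = length-filter is[-1]Dyck? (paths n 0)

t≡1+q : ∀ n → t n ≡ 1ℤ + + q n
t≡1+q n =
  trans (sumPaths-cong n 0 groundOrNone-split)
  (trans (sumOver-+ _ ground (paths n 0))
         (cong₂ _+_ (one-without-valleys n 0) (sym (q≡sumPaths n))))

q-convolution : ∀ m → + q (2 ℕ.+ m) ≡ conv m (λ a b → (1ℤ + + q a) * (1ℤ + + q (suc b)))
q-convolution m = begin
  + q (2 ℕ.+ m)
    ≡⟨ q≡sumPaths (2 ℕ.+ m) ⟩
  sumPaths (2 ℕ.+ m) 0 ground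
    ≡⟨ sumPaths-factor m ground (λ _ → 0ℤ) groundOrNone groundOrNone ground-empty ground-nonempty ⟩
  sumPaths (1 ℕ.+ m) 0 (λ _ → 0ℤ) + conv m (λ a b → t a * t (suc b))
    ≡⟨ cong₂ _+_ (sumOver-zero (λ _ → refl) (paths (1 ℕ.+ m) 0))
                 (conv-cong m (λ a b → cong₂ _*_ (t≡1+q a) (t≡1+q (suc b)))) ⟩
  0ℤ + conv m (λ a b → (1ℤ + + q a) * (1ℤ + + q (suc b)))
    ≡⟨ ℤ.+-identityˡ _ ⟩
  conv m (λ a b → (1ℤ + + q a) * (1ℤ + + q (suc b))) ∎
  where open ≡-Reasoning

r-convolution : ∀ m → + r (2 ℕ.+ m) ≡
                      + r (1 ℕ.+ m) + conv m (λ a b → (1ℤ + + q a) * + r (suc b))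
r-convolution m = begin
  + r (2 ℕ.+ m)
    ≡⟨ r≡sumPaths (2 ℕ.+ m) ⟩
  sumPaths (2 ℕ.+ m) 0 dyck
    ≡⟨ sumPaths-factor m dyck dyck groundOrNone dyck dyck-empty dyck-nonempty ⟩
  sumPaths (1 ℕ.+ m) 0 dyck + conv m (λ a b → t a * sumPaths (suc b) 0 dyck)
    ≡⟨ cong₂ _+_ (sym (r≡sumPaths (1 ℕ.+ m)))
                 (conv-cong m (λ a b → cong₂ _*_ (t≡1+q a) (sym (r≡sumPaths (suc b))))) ⟩
  + r (1 ℕ.+ m) + conv m (λ a b → (1ℤ + + q a) * + r (suc b)) ∎
  where open ≡-Reasoning

-- Recurrences

-- The increment of a convolution with 1 + x.  The summand 1 contributes a
-- telescoping sum.

convolution-step : ∀ m (x s : ℕ → ℤ) → s 1 ≡ 1ℤ →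
  conv (suc m) (λ a b → (1ℤ + x a) * s (suc b)) ≡
  conv m (λ a b → (1ℤ + x a) * s (suc b))
    + (x (suc m) + s (2 ℕ.+ m) + conv m (λ a b → x a * (s (2 ℕ.+ b) - s (1 ℕ.+ b))))
convolution-step m x s s1 = begin
  conv (suc m) F
    ≡⟨ conv-last m F ⟩
  conv m (λ a b → F a (suc b)) + (1ℤ + x (suc m)) * s 1
    ≡⟨ cong₂ _+_ split (cong ((1ℤ + x (suc m)) *_) s1) ⟩
  (conv m F + ((s (2 ℕ.+ m) - s 1) + X)) + (1ℤ + x (suc m)) * 1ℤ
    ≡⟨ cong (λ z → (conv m F + ((s (2 ℕ.+ m) - z) + X)) + (1ℤ + x (suc m)) * 1ℤ) s1 ⟩
  (conv m F + ((s (2 ℕ.+ m) - 1ℤ) + X)) + (1ℤ + x (suc m)) * 1ℤ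
    ≡⟨ collect (conv m F) (s (2 ℕ.+ m)) X (x (suc m)) ⟩
  conv m F + (x (suc m) + s (2 ℕ.+ m) + X) ∎
  where
  open ≡-Reasoning
  F : ℕ → ℕ → ℤ
  F a b = (1ℤ + x a) * s (suc b)
  X : ℤ
  X = conv m (λ a b → x a * (s (2 ℕ.+ b) - s (1 ℕ.+ b)))

  expand : ∀ i j k → (1ℤ + i) * j ≡ (1ℤ + i) * k + ((j - k) + i * (j - k))
  expand = solve-∀

  collect : ∀ c k u i → (c + ((k - 1ℤ) + u)) + (1ℤ + i) * 1ℤ ≡ c + (i + k + u)
  collect = solve-∀

  split : conv m (λ a b → F a (suc b)) ≡ conv m F + ((s (2 ℕ.+ m) - s 1) + X)
  split =
    trans (conv-cong m (λ a b → expand (x a) (s (2 ℕ.+ b)) (s (1 ℕ.+ b))))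
    (trans (conv-+ m F _)
           (+-congˡ (conv m F)
             (trans (conv-+ m (λ _ b → s (2 ℕ.+ b) - s (1 ℕ.+ b)) _)
                    (cong₂ _+_ (telescope m (s ∘ suc)) refl))))

-- If i = a and n = k + (a + b), then n - i = k + b.

k+[a+b]∸a : ∀ k a b → (k ℕ.+ (a ℕ.+ b)) ∸ a ≡ k ℕ.+ b
k+[a+b]∸a k a b = trans (ℕ.+-∸-assoc k (ℕ.m≤m+n a b)) (cong (k ℕ.+_) (ℕ.m+n∸m≡n a b))

-- With n = k + m and i = a, the arguments of s on the left are n - i - 1 and
-- n - i - 2.  The sum on the right may start at i = 2 because q 0 = q 1 = 0.

conv-as-∑ : ∀ k m (s : ℕ → ℕ) →
  conv m (λ a b → + q a * (+ s (k ℕ.+ b ∸ 1) - + s (k ℕ.+ b ∸ 2))) ≡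
  ∑[ i from 2 to m ] (+ q i * (+ s (k ℕ.+ m ∸ i ∸ 1) - + s (k ℕ.+ m ∸ i ∸ 2)))
conv-as-∑ k m s = conv-from-2 m _ _ (λ _ → refl) (λ _ → refl) same
  where
  same : ∀ a b → a ℕ.+ b ≡ m →
    + q a * (+ s (k ℕ.+ b ∸ 1) - + s (k ℕ.+ b ∸ 2)) ≡
    + q a * (+ s (k ℕ.+ m ∸ a ∸ 1) - + s (k ℕ.+ m ∸ a ∸ 2))
  same a b refl = cong (λ c → + q a * (+ s (c ∸ 1) - + s (c ∸ 2))) (sym (k+[a+b]∸a k a b))

q-recurrence : ∀ m → let n = 4 ℕ.+ m in
  + q n ≡ (+ 2) * (+ q (n ∸ 1)) + (+ q (n ∸ 2)) + (+ q (n ∸ 3))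
        + (∑[ i from 2 to (n ∸ 4) ]
             ((+ q i) * ((+ q (n ∸ i ∸ 1)) - (+ q (n ∸ i ∸ 2)))))
        + (+ 1)
q-recurrence m = begin
  + q (4 ℕ.+ m)
    ≡⟨ q-convolution (2 ℕ.+ m) ⟩
  conv (2 ℕ.+ m) (λ a b → (1ℤ + + q a) * (1ℤ + + q (suc b)))
    ≡⟨ convolution-step (1 ℕ.+ m) (λ a → + q a) (λ b → 1ℤ + + q b) refl ⟩
  conv (1 ℕ.+ m) (λ a b → (1ℤ + + q a) * (1ℤ + + q (suc b)))
    + (+ q (2 ℕ.+ m) + (1ℤ + + q (3 ℕ.+ m)) + X)
    ≡⟨ cong₂ _+_ (sym (q-convolution (1 ℕ.+ m)))
                 (+-congˡ (+ q (2 ℕ.+ m) + (1ℤ + + q (3 ℕ.+ m))) X≡) ⟩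
  + q (3 ℕ.+ m) + (+ q (2 ℕ.+ m) + (1ℤ + + q (3 ℕ.+ m)) + (Σ + + q (1 ℕ.+ m)))
    ≡⟨ collect (+ q (3 ℕ.+ m)) (+ q (2 ℕ.+ m)) (+ q (1 ℕ.+ m)) Σ ⟩
  (+ 2) * + q (3 ℕ.+ m) + + q (2 ℕ.+ m) + + q (1 ℕ.+ m) + Σ + (+ 1) ∎
  where
  open ≡-Reasoning
  X Σ : ℤ
  X = conv (1 ℕ.+ m) (λ a b → + q a * ((1ℤ + + q (2 ℕ.+ b)) - (1ℤ + + q (1 ℕ.+ b))))
  Σ = ∑[ i from 2 to m ] (+ q i * (+ q (4 ℕ.+ m ∸ i ∸ 1) - + q (4 ℕ.+ m ∸ i ∸ 2)))

  cancel-1 : ∀ i j k → i * ((1ℤ + j) - (1ℤ + k)) ≡ i * (j - k)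
  cancel-1 = solve-∀

  collect : ∀ i j k l → i + (j + (1ℤ + i) + (l + k)) ≡ (+ 2) * i + j + k + l + (+ 1)
  collect = solve-∀

  -- The last term has the factor q 2 - q 1 = 1.
  X≡ : X ≡ Σ + + q (1 ℕ.+ m)
  X≡ =
    trans (conv-cong (1 ℕ.+ m) (λ a b → cancel-1 (+ q a) (+ q (2 ℕ.+ b)) (+ q (1 ℕ.+ b))))
    (trans (conv-last m (λ a b → + q a * (+ q (2 ℕ.+ b) - + q (1 ℕ.+ b))))
           (cong₂ _+_ (conv-as-∑ 4 m q) (ℤ.*-identityʳ (+ q (1 ℕ.+ m)))))

r-recurrence : ∀ m → let n = 4 ℕ.+ m in
  + r n ≡ (+ 3) * (+ r (n ∸ 1)) - (+ r (n ∸ 2)) + (+ q (n ∸ 2))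
        + (∑[ i from 2 to (n ∸ 3) ]
             ((+ q i) * ((+ r (n ∸ i ∸ 1)) - (+ r (n ∸ i ∸ 2)))))
r-recurrence m = begin
  + r (4 ℕ.+ m)
    ≡⟨ r-convolution (2 ℕ.+ m) ⟩
  + r (3 ℕ.+ m) + conv (2 ℕ.+ m) F
    ≡⟨ +-congˡ (+ r (3 ℕ.+ m)) (convolution-step (1 ℕ.+ m) (λ a → + q a) (λ b → + r b) refl) ⟩
  + r (3 ℕ.+ m) + (conv (1 ℕ.+ m) F + (+ q (2 ℕ.+ m) + + r (3 ℕ.+ m) + X))
    ≡⟨ collect (+ r (3 ℕ.+ m)) (+ r (2 ℕ.+ m)) (conv (1 ℕ.+ m) F) (+ q (2 ℕ.+ m)) X
         (r-convolution (1 ℕ.+ m)) ⟩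
  (+ 3) * + r (3 ℕ.+ m) - + r (2 ℕ.+ m) + + q (2 ℕ.+ m) + X
    ≡⟨ +-congˡ ((+ 3) * + r (3 ℕ.+ m) - + r (2 ℕ.+ m) + + q (2 ℕ.+ m)) (conv-as-∑ 3 (1 ℕ.+ m) r) ⟩
  (+ 3) * + r (3 ℕ.+ m) - + r (2 ℕ.+ m) + + q (2 ℕ.+ m)
    + (∑[ i from 2 to (1 ℕ.+ m) ] (+ q i * (+ r (4 ℕ.+ m ∸ i ∸ 1) - + r (4 ℕ.+ m ∸ i ∸ 2)))) ∎
  where
  open ≡-Reasoning
  F : ℕ → ℕ → ℤ
  F a b = (1ℤ + + q a) * + r (suc b)
  X : ℤ
  X = conv (1 ℕ.+ m) (λ a b → + q a * (+ r (2 ℕ.+ b) - + r (1 ℕ.+ b)))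

  rearrange : ∀ j c k u → (j + c) + (c + (k + (j + c) + u)) ≡ (+ 3) * (j + c) - j + k + u
  rearrange = solve-∀

  collect : ∀ i j c k u → i ≡ j + c → i + (c + (k + i + u)) ≡ (+ 3) * i - j + k + u
  collect i j c k u refl = rearrange j c k u

corollary3p5 : ( (∀ (n : ℕ) → n > 3 →
    + q n ≡ (+ 2) * (+ q (n ∸ 1)) + (+ q (n ∸ 2)) + (+ q (n ∸ 3))
    + (∑[ i from 2 to (n ∸ 4) ]
    ((+ q i) * ((+ q (n ∸ i ∸ 1)) - (+ q (n ∸ i ∸ 2)))))
    + (+ 1))
    × q 1 ≡ 0 × q 2 ≡ 1 × q 3 ≡ 3 )
    ×
    ( (∀ (n : ℕ) → n > 3 →
    + r n ≡ (+ 3) * (+ r (n ∸ 1)) - (+ r (n ∸ 2)) + (+ q (n ∸ 2))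
    + (∑[ i from 2 to (n ∸ 3) ]
    ((+ q i) * ((+ r (n ∸ i ∸ 1)) - (+ r (n ∸ i ∸ 2)))))
    )
    × r 1 ≡ 1 × r 2 ≡ 2 × r 3 ≡ 5 )
corollary3p5 =
  ( (λ { _ (s≤s (s≤s (s≤s (s≤s (z≤n {m}))))) → q-recurrence m })
  , refl , refl , refl ) ,
  ( (λ { _ (s≤s (s≤s (s≤s (s≤s (z≤n {m}))))) → r-recurrence m })
  , refl , refl , refl )
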